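{- Each of GVC, GVC1 and GVC2 is equivalent to the unconstrained binary quadratic programming problem UBQP: every instance of one can be formulated as an instance of the other such that an optimal solution of the new instance yields an optimal solution of the original instance (identifying $U\subseteq\{1,\dots,n\}$ with its incidence vector $x\in\{0,1\}^n$).
   Context: Let $G=(V,E)$ be a graph with $V=\{1,\dots,n\}$, vertex weights $c_i\in\mathbb{R}$ and edge weights $q^0_{ij},q^1_{ij},q^2_{ij}\in\mathbb{R}$. For $U\subseteq V$ let $E_0(U)$, $E_1(U)$, $E_2(U)$ be the sets of edges with zero, exactly one, and two endpoints in $U$, respectively, and $f(U)=\sum_{i\in U}c_i+\sum_{E_0(U)}q^0_{ij}+\sum_{E_1(U)}q^1_{ij}+\sum_{E_2(U)}q^2_{ij}$. GVC asks for $U\subseteq V$ minimizing $f(U)$; GVC1 is the special case $q^1\equiv q^2\equiv0$, GVC2 the special case $q^0\equiv q^1\equiv 0$. UBQP: given a symmetric real $n\times n$ matrix $Q=(q_{ij})$ with zero diagonal and a vector $a\in\mathbb{R}^n$, find $x\in\{0,1\}^n$ minimizing $\sum_i a_ix_i+\sum_{i=1}^n\sum_{j=1}^n q_{ij}x_ix_j$. Two problems are equivalent if each can be formulated as the other so that an optimal solution of the formulated instance gives an optimal solution of the original. -}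

module Defs where

open import Algebra.Apartness.Bundles using (HeytingField)
open import Algebra.Bundles using (CommutativeRing)
import Algebra.Properties.Semiring.Mult
import Algebra.Properties.Semiring.Sum
open import Data.Bool.Base using (Bool; true; false; if_then_else_; _∧_; _xor_; not)
open import Data.Fin.Base using (Fin)
open import Data.Fin.Properties using (_<?_)
open import Data.Fin.Subset using (Subset)
open import Data.Nat.Base as ℕ using (ℕ)
open import Data.Product.Base using (Σ; ∃-syntax; _×_; proj₁)
open import Data.Sum.Base using (_⊎_)
open import Data.Vec.Base using (Vec; lookup)
open import Data.Vec.Functional using (Vector)
open import Function.Bundles using (_⇔_)
open import Level using (Level; _⊔_) renaming (suc to lsuc)
open import Relation.Binary.Core using (Rel)
open import Relation.Binary.PropositionalEquality.Core using (_≡_)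
open import Relation.Binary.Structures using (IsStrictPartialOrder)
open import Relation.Nullary.Decidable.Core using (does)
open import Relation.Nullary.Negation.Core using (¬_)

-- The real numbers, presented as a Cauchy-complete Archimedean ordered field.
-- Classically this determines ℝ up to isomorphism.  The order is not assumed
-- decidable, so that Bishop's Cauchy reals are also a model.
record RealNumbers c ℓ₁ ℓ₂ : Set (lsuc (c ⊔ ℓ₁ ⊔ ℓ₂)) where
  infix 4 _<_ _≤_

  field
    heytingField : HeytingField c ℓ₁ ℓ₂

  open HeytingField heytingField public

  realCommutativeRing : CommutativeRing c ℓ₁
  realCommutativeRing = record { isCommutativeRing = isCommutativeRing }

  open CommutativeRing realCommutativeRing public using (semiring)
  open Algebra.Properties.Semiring.Mult semiring public using () renaming (_×_ to _·_)
  open Algebra.Properties.Semiring.Sum semiring public using (sum; sum-syntax)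

  field
    _<_                  : Rel Carrier ℓ₂
    isStrictPartialOrder : IsStrictPartialOrder _≈_ _<_
    #⇔<⊎>                : ∀ x y → x # y ⇔ (x < y ⊎ y < x)
    +-monoˡ-<            : ∀ x y z → x < y → x + z < y + z
    *-pos                : ∀ x y → 0# < x → 0# < y → 0# < x * y
    archimedean          : ∀ x → ∃[ m ] x < m · 1#

  _≤_ : Rel Carrier ℓ₂
  x ≤ y = ¬ (y < x)

  -- |x - y| < ε
  Close : Carrier → Rel Carrier ℓ₂
  Close ε x y = x < y + ε × y < x + ε

  field
    cauchy-complete :
      ∀ (s : ℕ → Carrier) →
      (∀ ε → 0# < ε → ∃[ N ] ∀ k l → N ℕ.≤ k → N ℕ.≤ l → Close ε (s k) (s l)) →
      ∃[ L ] ∀ ε → 0# < ε → ∃[ N ] ∀ k → N ℕ.≤ k → Close ε (s k) L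

record Graph (n : ℕ) : Set where
  field
    adj      : Fin n → Fin n → Bool
    adj-sym  : ∀ i j → adj i j ≡ adj j i
    loopless : ∀ i → adj i i ≡ false

  E₀ E₁ E₂ : Subset n → Fin n → Fin n → Bool
  E₀ U i j = adj i j ∧ (not (lookup U i) ∧ not (lookup U j))
  E₁ U i j = adj i j ∧ (lookup U i xor lookup U j)
  E₂ U i j = adj i j ∧ (lookup U i ∧ lookup U j)

module _ {c ℓ₁ ℓ₂ : Level} (R : RealNumbers c ℓ₁ ℓ₂) where
  open RealNumbers R

  -- Feasible points are shared by all problems: a set of vertices and its
  -- incidence vector are the same thing, as Subset n is by definition Vec Bool n.
  record MinimizationProblem : Set (lsuc (c ⊔ ℓ₁)) where
    field
      Instance  : ℕ → Set (c ⊔ ℓ₁)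
      objective : ∀ {n} → Instance n → Subset n → Carrier

    Optimal : ∀ {n} → Instance n → Subset n → Set ℓ₂
    Optimal I U = ∀ W → objective I U ≤ objective I W

  open MinimizationProblem

  FormulatedAs : MinimizationProblem → MinimizationProblem → Set (c ⊔ ℓ₁ ⊔ ℓ₂)
  FormulatedAs P Q =
    ∀ {n} (I : Instance P n) → Σ (Instance Q n) λ J →
    ∀ U → Optimal Q J U → Optimal P I U

  Equivalent : MinimizationProblem → MinimizationProblem → Set (c ⊔ ℓ₁ ⊔ ℓ₂)
  Equivalent P Q = FormulatedAs P Q × FormulatedAs Q P

  -- Edge weights are symmetric functions on all pairs; only their values on
  -- edges are ever used.
  record GVCInstance (n : ℕ) : Set (c ⊔ ℓ₁) where
    field
      graph    : Graph n
      weight   : Vector Carrier n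
      q⁰ q¹ q² : Fin n → Fin n → Carrier
      q⁰-sym   : ∀ i j → q⁰ i j ≈ q⁰ j i
      q¹-sym   : ∀ i j → q¹ i j ≈ q¹ j i
      q²-sym   : ∀ i j → q² i j ≈ q² j i

    open Graph graph public

  -- Each unordered pair {i , j} is counted once, through i < j.
  sumOverEdges : ∀ {n} → (Fin n → Fin n → Bool) → (Fin n → Fin n → Carrier) → Carrier
  sumOverEdges {n} S q =
    ∑[ i < n ] ∑[ j < n ] (if does (i <? j) ∧ S i j then q i j else 0#)

  gvcObjective : ∀ {n} → GVCInstance n → Subset n → Carrier
  gvcObjective {n} I U =
    (∑[ i < n ] (if lookup U i then weight i else 0#))
      + sumOverEdges (E₀ U) q⁰
      + sumOverEdges (E₁ U) q¹
      + sumOverEdges (E₂ U) q²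
    where open GVCInstance I

  VanishesOnEdges : ∀ {n} → Graph n → (Fin n → Fin n → Carrier) → Set ℓ₁
  VanishesOnEdges G q = ∀ i j → Graph.adj G i j ≡ true → q i j ≈ 0#

  GVC1Instance GVC2Instance : ℕ → Set (c ⊔ ℓ₁)
  GVC1Instance n = Σ (GVCInstance n) λ I → let open GVCInstance I in
    VanishesOnEdges graph q¹ × VanishesOnEdges graph q²
  GVC2Instance n = Σ (GVCInstance n) λ I → let open GVCInstance I in
    VanishesOnEdges graph q⁰ × VanishesOnEdges graph q¹

  GVC GVC1 GVC2 : MinimizationProblem
  GVC  = record { Instance = GVCInstance  ; objective = gvcObjective }
  GVC1 = record { Instance = GVC1Instance ; objective = λ I → gvcObjective (proj₁ I) }
  GVC2 = record { Instance = GVC2Instance ; objective = λ I → gvcObjective (proj₁ I) }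

  record UBQPInstance (n : ℕ) : Set (c ⊔ ℓ₁) where
    field
      a      : Vector Carrier n
      Q      : Fin n → Fin n → Carrier
      Q-sym  : ∀ i j → Q i j ≈ Q j i
      Q-diag : ∀ i → Q i i ≈ 0#

  bit : Bool → Carrier
  bit b = if b then 1# else 0#

  ubqpObjective : ∀ {n} → UBQPInstance n → Vec Bool n → Carrier
  ubqpObjective {n} I v =
    (∑[ i < n ] (a i * x i)) + (∑[ i < n ] ∑[ j < n ] (Q i j * x i * x j))
    where
    open UBQPInstance I
    x : Vector Carrier n
    x i = bit (lookup v i)

  UBQP : MinimizationProblem
  UBQP = record { Instance = UBQPInstance ; objective = ubqpObjective }

{-# OPTIONS --safe #-}

-- A function of two bits that depends only on their sum is
-- q⁰ + (q¹ - q⁰)(x + y) + (q² - 2 q¹ + q⁰) x y.  Hence twice a GVC objective,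
-- summed over ordered pairs, is a UBQP objective plus a constant (doubling
-- avoids dividing by 2).  Conversely, every UBQP objective is, up to a constant,
-- the objective of a complete graph with pair costs (q⁰ , q¹ , q²) = (2Q , 0 , 0)
-- or (0 , 0 , 2Q): both have second difference 2Q, and the linear terms they
-- produce are absorbed in the vertex weights.

module Submission where

open import Defs
open import Algebra.Bundles using (CommutativeRing)
import Algebra.Properties.Group
import Algebra.Properties.Semiring.Sum
import Algebra.Solver.Ring.NaturalCoefficients.Default
open import Data.Bool.Base using (Bool; true; false; if_then_else_; not; _∧_; _xor_)
open import Data.Fin.Base using (Fin)
open import Data.Fin.Properties using (_<?_; _≟_; <-cmp)
open import Data.Fin.Subset using (Subset)
open import Data.Nat.Base using (ℕ)
open import Data.Product.Base using (_×_; _,_; proj₁)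
open import Data.Vec.Base using (lookup)
open import Data.Vec.Functional using (Vector)
open import Function.Bundles using (mk⇔)
open import Level using (Level; _⊔_)
open import Relation.Binary.Definitions using (tri<; tri≈; tri>)
open import Relation.Binary.PropositionalEquality as ≡ using (_≡_)
import Relation.Binary.Reasoning.Setoid
open import Relation.Binary.Structures using (IsStrictPartialOrder)
open import Relation.Nullary.Decidable using (does; yes; no; dec-true; dec-false; does-⇔)

completeGraph : ∀ n → Graph n
completeGraph n = record
  { adj      = λ i j → not (does (i ≟ j))
  ; adj-sym  = λ i j → ≡.cong not (does-⇔ (mk⇔ ≡.sym ≡.sym) (i ≟ j) (j ≟ i))
  ; loopless = λ i → ≡.cong not (dec-true (i ≟ i) ≡.refl)
  }

module _ {c ℓ₁ ℓ₂ : Level} (R : RealNumbers c ℓ₁ ℓ₂) where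
  open RealNumbers R
    using (_<_; isStrictPartialOrder; +-monoˡ-<; realCommutativeRing)
  open CommutativeRing realCommutativeRing
  open Algebra.Properties.Semiring.Sum semiring
  open Algebra.Properties.Group +-group
    using (//-rightDividesˡ; //-rightDividesʳ; ε⁻¹≈ε)
  open Algebra.Solver.Ring.NaturalCoefficients.Default commutativeSemiring
    using (solve; _:+_; _:=_)
  open Relation.Binary.Reasoning.Setoid setoid
  open IsStrictPartialOrder isStrictPartialOrder using (<-respʳ-≈; <-respˡ-≈)
    renaming (trans to <-trans)

  private
    Matrix : ℕ → Set c
    Matrix n = Fin n → Fin n → Carrier

    Symmetric ZeroDiagonal : ∀ {n} → Matrix n → Set ℓ₁
    Symmetric    A = ∀ i j → A i j ≈ A j i
    ZeroDiagonal A = ∀ i → A i i ≈ 0#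

    variable
      n : ℕ

  -- Doubling, differences and conditionals.

  twice : Carrier → Carrier
  twice x = x + x

  twice-cong : ∀ {x y} → x ≈ y → twice x ≈ twice y
  twice-cong x≈y = +-cong x≈y x≈y

  twice-+ : ∀ x y → twice (x + y) ≈ twice x + twice y
  twice-+ = solve 2 (λ x y → (x :+ y) :+ (x :+ y) := (x :+ x) :+ (y :+ y)) refl

  x+[y-x]≈y : ∀ x y → x + (y - x) ≈ y
  x+[y-x]≈y x y = trans (+-comm x (y - x)) (//-rightDividesˡ x y)

  0+twice[0-0]≈0 : 0# + twice (0# - 0#) ≈ 0#
  0+twice[0-0]≈0 = begin
    0# + twice (0# - 0#)  ≈⟨ +-identityˡ _ ⟩
    twice (0# - 0#)  ≈⟨ twice-cong (-‿inverseʳ 0#) ⟩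
    twice 0#  ≈⟨ +-identityˡ 0# ⟩
    0#  ∎

  if-cong : ∀ b {x y} → x ≈ y → (if b then x else 0#) ≈ (if b then y else 0#)
  if-cong true  x≈y = x≈y
  if-cong false x≈y = refl

  if-+ : ∀ b x y → (if b then x + y else 0#)
                 ≈ (if b then x else 0#) + (if b then y else 0#)
  if-+ true  x y = refl
  if-+ false x y = sym (+-identityˡ 0#)

  if≈*bit : ∀ b x → (if b then x else 0#) ≈ x * bit R b
  if≈*bit true  x = sym (*-identityʳ x)
  if≈*bit false x = sym (zeroʳ x)

  -- Sums over ordered pairs and over increasing pairs.

  ∑∑ : Matrix n → Carrier
  ∑∑ {n} A = ∑[ i < n ] ∑[ j < n ] A i j

  ∑∑-cong : {A B : Matrix n} → (∀ i j → A i j ≈ B i j) → ∑∑ A ≈ ∑∑ B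
  ∑∑-cong A≈B = sum-cong-≋ (λ i → sum-cong-≋ (A≈B i))

  ∑∑-distrib-+ : (A B : Matrix n) → ∑∑ (λ i j → A i j + B i j) ≈ ∑∑ A + ∑∑ B
  ∑∑-distrib-+ A B = trans (sum-cong-≋ (λ i → ∑-distrib-+ (A i) (B i)))
                           (∑-distrib-+ (λ i → sum (A i)) (λ i → sum (B i)))

  ∑<∑ : Matrix n → Carrier
  ∑<∑ A = ∑∑ (λ i j → if does (i <? j) then A i j else 0#)

  ∑<∑-cong : {A B : Matrix n} → (∀ i j → A i j ≈ B i j) → ∑<∑ A ≈ ∑<∑ B
  ∑<∑-cong A≈B = ∑∑-cong (λ i j → if-cong (does (i <? j)) (A≈B i j))

  ∑<∑-distrib-+ : (A B : Matrix n) → ∑<∑ (λ i j → A i j + B i j) ≈ ∑<∑ A + ∑<∑ B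
  ∑<∑-distrib-+ A B =
    trans (∑∑-cong (λ i j → if-+ (does (i <? j)) (A i j) (B i j)))
          (∑∑-distrib-+ (λ i j → if does (i <? j) then A i j else 0#)
                        (λ i j → if does (i <? j) then B i j else 0#))

  -- Transposing one of the two copies of the strict upper triangle gives the strict lower triangle,
  -- by symmetry of `A`, and the missing diagonal is zero. This links the edge sums of GVC, which
  -- count a pair once, to the ordered double sum of UBQP.
  twice-∑<∑ : (A : Matrix n) → Symmetric A → ZeroDiagonal A → twice (∑<∑ A) ≈ ∑∑ A
  twice-∑<∑ A A-sym A-diag = begin
    ∑<∑ A + ∑<∑ A  ≈⟨ +-congˡ (∑-comm upper) ⟩
    ∑<∑ A + ∑∑ (λ i j → upper j i)  ≈⟨ ∑∑-distrib-+ upper (λ i j → upper j i) ⟨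
    ∑∑ (λ i j → upper i j + upper j i)  ≈⟨ ∑∑-cong upper+lower ⟩
    ∑∑ A  ∎
    where
    upper : Matrix _
    upper i j = if does (i <? j) then A i j else 0#

    upper+lower : ∀ i j → upper i j + upper j i ≈ A i j
    upper+lower i j with <-cmp i j
    ... | tri< i<j _ i≯j rewrite dec-true (i <? j) i<j | dec-false (j <? i) i≯j =
      +-identityʳ (A i j)
    ... | tri≈ i≮i ≡.refl _ rewrite dec-false (i <? i) i≮i =
      trans (+-identityʳ 0#) (sym (A-diag i))
    ... | tri> i≮j _ i>j rewrite dec-false (i <? j) i≮j | dec-true (j <? i) i>j =
      trans (+-identityˡ (A j i)) (A-sym j i)

  -- Functions of the number of set bits among two.

  -- The cost of a pair with 0, 1 or 2 members in U.
  choose : Carrier → Carrier → Carrier → Bool → Bool → Carrier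
  choose q⁰ q¹ q² false false = q⁰
  choose q⁰ q¹ q² false true  = q¹
  choose q⁰ q¹ q² true  false = q¹
  choose q⁰ q¹ q² true  true  = q²

  choose-comm : ∀ {p⁰ p¹ p² q⁰ q¹ q²} → p⁰ ≈ q⁰ → p¹ ≈ q¹ → p² ≈ q² →
                ∀ b b′ → choose p⁰ p¹ p² b b′ ≈ choose q⁰ q¹ q² b′ b
  choose-comm e⁰ e¹ e² false false = e⁰
  choose-comm e⁰ e¹ e² false true  = e¹
  choose-comm e⁰ e¹ e² true  false = e¹
  choose-comm e⁰ e¹ e² true  true  = e²

  choose-zero : ∀ {q⁰ q¹ q²} → q⁰ ≈ 0# → q¹ ≈ 0# → q² ≈ 0# →
                ∀ b b′ → choose q⁰ q¹ q² b b′ ≈ 0#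
  choose-zero e⁰ e¹ e² false false = e⁰
  choose-zero e⁰ e¹ e² false true  = e¹
  choose-zero e⁰ e¹ e² true  false = e¹
  choose-zero e⁰ e¹ e² true  true  = e²

  choose-twice : ∀ q⁰ q¹ q² b b′ → choose (twice q⁰) (twice q¹) (twice q²) b b′
                                 ≈ choose q⁰ q¹ q² b b′ + choose q⁰ q¹ q² b b′
  choose-twice q⁰ q¹ q² false false = refl
  choose-twice q⁰ q¹ q² false true  = refl
  choose-twice q⁰ q¹ q² true  false = refl
  choose-twice q⁰ q¹ q² true  true  = refl

  firstDifference : Carrier → Carrier → Carrier
  firstDifference q⁰ q¹ = q¹ - q⁰

  -- Written as `q²` minus the value at two of the line through `q⁰` and `q¹`, so that `x+[y-x]≈y`
  -- settles the case of two set bits directly.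
  secondDifference : Carrier → Carrier → Carrier → Carrier
  secondDifference q⁰ q¹ q² = q² - (q⁰ + twice (firstDifference q⁰ q¹))

  -- This is Newton forward interpolation at 0, 1, 2 in the number of set bits: the product of the
  -- two bits is the binomial coefficient of that number over 2.
  choose-interpolation : ∀ q⁰ q¹ q² b b′ → choose q⁰ q¹ q² b b′ ≈
    (q⁰ + firstDifference q⁰ q¹ * (bit R b + bit R b′)) + secondDifference q⁰ q¹ q² * bit R b * bit R b′
  choose-interpolation q⁰ q¹ q² b b′ = sym (go b b′)
    where
    B = firstDifference q⁰ q¹
    C = secondDifference q⁰ q¹ q²

    go : ∀ b b′ → (q⁰ + B * (bit R b + bit R b′)) + C * bit R b * bit R b′
                ≈ choose q⁰ q¹ q² b b′
    go false false = begin
      (q⁰ + B * (0# + 0#)) + C * 0# * 0#  ≈⟨ +-cong (+-congˡ (*-congˡ (+-identityˡ 0#))) (zeroʳ _) ⟩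
      (q⁰ + B * 0#) + 0#  ≈⟨ +-identityʳ _ ⟩
      q⁰ + B * 0#  ≈⟨ +-congˡ (zeroʳ B) ⟩
      q⁰ + 0#  ≈⟨ +-identityʳ q⁰ ⟩
      q⁰  ∎
    go false true = begin
      (q⁰ + B * (0# + 1#)) + C * 0# * 1#  ≈⟨ +-cong (+-congˡ (*-congˡ (+-identityˡ 1#))) (trans (*-identityʳ _) (zeroʳ C)) ⟩
      (q⁰ + B * 1#) + 0#  ≈⟨ +-identityʳ _ ⟩
      q⁰ + B * 1#  ≈⟨ +-congˡ (*-identityʳ B) ⟩
      q⁰ + B  ≈⟨ x+[y-x]≈y q⁰ q¹ ⟩
      q¹  ∎
    go true false = begin
      (q⁰ + B * (1# + 0#)) + C * 1# * 0#  ≈⟨ +-cong (+-congˡ (*-congˡ (+-identityʳ 1#))) (zeroʳ _) ⟩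
      (q⁰ + B * 1#) + 0#  ≈⟨ +-identityʳ _ ⟩
      q⁰ + B * 1#  ≈⟨ +-congˡ (*-identityʳ B) ⟩
      q⁰ + B  ≈⟨ x+[y-x]≈y q⁰ q¹ ⟩
      q¹  ∎
    go true true = begin
      (q⁰ + B * (1# + 1#)) + C * 1# * 1#  ≈⟨ +-cong (+-congˡ (distribˡ B 1# 1#)) (*-identityʳ _) ⟩
      (q⁰ + twice (B * 1#)) + C * 1#  ≈⟨ +-cong (+-congˡ (twice-cong (*-identityʳ B))) (*-identityʳ C) ⟩
      (q⁰ + twice B) + C  ≈⟨ x+[y-x]≈y (q⁰ + twice B) q² ⟩
      q²  ∎

  -- Symmetric pair costs and their summation.

  -- The common ground of both reductions: costs on all pairs, without a graph. The zero diagonals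
  -- make every `cost U` eligible for `twice-∑<∑` and give `curvature` the zero diagonal that UBQP
  -- demands.
  record PairCosts n : Set (c ⊔ ℓ₁) where
    field
      q⁰ q¹ q² : Matrix n
      q⁰-sym   : Symmetric q⁰
      q¹-sym   : Symmetric q¹
      q²-sym   : Symmetric q²
      q⁰-diag  : ZeroDiagonal q⁰
      q¹-diag  : ZeroDiagonal q¹
      q²-diag  : ZeroDiagonal q²

    cost : Subset n → Matrix n
    cost U i j = choose (q⁰ i j) (q¹ i j) (q² i j) (lookup U i) (lookup U j)

    cost-sym : ∀ U → Symmetric (cost U)
    cost-sym U i j = choose-comm (q⁰-sym i j) (q¹-sym i j) (q²-sym i j) (lookup U i) (lookup U j)

    cost-diag : ∀ U → ZeroDiagonal (cost U)
    cost-diag U i = choose-zero (q⁰-diag i) (q¹-diag i) (q²-diag i) (lookup U i) (lookup U i)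

    slope curvature : Matrix n
    slope     i j = firstDifference (q⁰ i j) (q¹ i j)
    curvature i j = secondDifference (q⁰ i j) (q¹ i j) (q² i j)

    slope-sym : Symmetric slope
    slope-sym i j = +-cong (q¹-sym i j) (-‿cong (q⁰-sym i j))

    curvature-sym : Symmetric curvature
    curvature-sym i j =
      +-cong (q²-sym i j) (-‿cong (+-cong (q⁰-sym i j) (twice-cong (slope-sym i j))))

    curvature-diag : ZeroDiagonal curvature
    curvature-diag i = begin
      q² i i - (q⁰ i i + twice (q¹ i i - q⁰ i i))
        ≈⟨ +-cong (q²-diag i) (-‿cong (+-cong (q⁰-diag i)
             (twice-cong (+-cong (q¹-diag i) (-‿cong (q⁰-diag i)))))) ⟩
      0# - (0# + twice (0# - 0#))  ≈⟨ +-congˡ (-‿cong 0+twice[0-0]≈0) ⟩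
      0# - 0#  ≈⟨ -‿inverseʳ 0# ⟩
      0#  ∎

  linear : Vector Carrier n → Subset n → Carrier
  linear {n} a U = ∑[ i < n ] (a i * bit R (lookup U i))

  quadratic : Matrix n → Subset n → Carrier
  quadratic Q U = ∑∑ (λ i j → Q i j * bit R (lookup U i) * bit R (lookup U j))

  linear-+ : (a b : Vector Carrier n) (U : Subset n) →
             linear (λ i → a i + b i) U ≈ linear a U + linear b U
  linear-+ a b U = trans
    (sum-cong-≋ (λ i → distribʳ (bit R (lookup U i)) (a i) (b i)))
    (∑-distrib-+ (λ i → a i * bit R (lookup U i)) (λ i → b i * bit R (lookup U i)))

  rowSums : Matrix n → Vector Carrier n
  rowSums A i = sum (A i)

  -- Exchanging the order of summation and using symmetry turns the `x j` half into the `x i` half,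
  -- and each half is the linear form of the row sums. Hence pair terms of degree one can be moved
  -- into vertex weights.
  ∑∑-pairLinear : (B : Matrix n) → Symmetric B → (U : Subset n) →
    ∑∑ (λ i j → B i j * (bit R (lookup U i) + bit R (lookup U j)))
      ≈ linear (λ i → twice (rowSums B i)) U
  ∑∑-pairLinear {n} B B-sym U = begin
    ∑∑ (λ i j → B i j * (x i + x j))
      ≈⟨ ∑∑-cong (λ i j → distribˡ (B i j) (x i) (x j)) ⟩
    ∑∑ (λ i j → B i j * x i + B i j * x j)
      ≈⟨ ∑∑-distrib-+ (λ i j → B i j * x i) (λ i j → B i j * x j) ⟩
    ∑∑ (λ i j → B i j * x i) + ∑∑ (λ i j → B i j * x j)
      ≈⟨ +-congˡ (trans (∑-comm (λ i j → B i j * x j))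
                        (∑∑-cong (λ i j → *-congʳ (B-sym j i)))) ⟩
    twice (∑∑ (λ i j → B i j * x i))
      ≈⟨ twice-cong (sum-cong-≋ (λ i → *-distribʳ-sum (x i) (B i))) ⟨
    twice (linear (rowSums B) U)
      ≈⟨ linear-+ (rowSums B) (rowSums B) U ⟨
    linear (λ i → twice (rowSums B i)) U  ∎
    where
    x : Vector Carrier n
    x i = bit R (lookup U i)

  module _ (P : PairCosts n) where
    open PairCosts P

    -- Summing the interpolation formula over all ordered pairs separates a constant independent of
    -- `U`, a linear form and a quadratic form. Both reductions compare these three parts with a
    -- UBQP objective.
    ∑∑-cost : ∀ U → ∑∑ (cost U)
      ≈ (∑∑ q⁰ + linear (λ i → twice (rowSums slope i)) U) + quadratic curvature U
    ∑∑-cost U = begin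
      ∑∑ (cost U)
        ≈⟨ ∑∑-cong (λ i j → choose-interpolation (q⁰ i j) (q¹ i j) (q² i j) (lookup U i) (lookup U j)) ⟩
      ∑∑ (λ i j → (q⁰ i j + S i j) + T i j)
        ≈⟨ ∑∑-distrib-+ (λ i j → q⁰ i j + S i j) T ⟩
      ∑∑ (λ i j → q⁰ i j + S i j) + ∑∑ T
        ≈⟨ +-congʳ (∑∑-distrib-+ q⁰ S) ⟩
      (∑∑ q⁰ + ∑∑ S) + ∑∑ T
        ≈⟨ +-congʳ (+-congˡ (∑∑-pairLinear slope slope-sym U)) ⟩
      (∑∑ q⁰ + linear (λ i → twice (rowSums slope i)) U) + quadratic curvature U  ∎
      where
      S T : Matrix n
      S i j = slope i j * (bit R (lookup U i) + bit R (lookup U j))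
      T i j = curvature i j * bit R (lookup U i) * bit R (lookup U j)

  -- From GVC to UBQP.

  edgeCost : GVCInstance R n → Subset n → Matrix n
  edgeCost I U i j =
    if adj i j then choose (q⁰ i j) (q¹ i j) (q² i j) (lookup U i) (lookup U j) else 0#
    where open GVCInstance I

  -- Each edge lies in exactly one of `E₀ U`, `E₁ U`, `E₂ U`, so at every pair at most one of the
  -- three summands survives and the edge sums merge into one.
  gvcObjective≈ : (I : GVCInstance R n) (U : Subset n) →
    gvcObjective R I U ≈ linear (GVCInstance.weight I) U + ∑<∑ (edgeCost I U)
  gvcObjective≈ {n} I U = begin
    gvcObjective R I U
      ≈⟨ solve 4 (λ w a b d → w :+ a :+ b :+ d := w :+ (a :+ b :+ d)) refl
           (∑[ i < n ] (if lookup U i then weight i else 0#))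
           (sumOverEdges R (E₀ U) q⁰) (sumOverEdges R (E₁ U) q¹) (sumOverEdges R (E₂ U) q²) ⟩
    (∑[ i < n ] (if lookup U i then weight i else 0#))
      + (∑∑ t⁰ + ∑∑ t¹ + ∑∑ t²)
      ≈⟨ +-congʳ (sum-cong-≋ (λ i → if≈*bit (lookup U i) (weight i))) ⟩
    linear weight U + (∑∑ t⁰ + ∑∑ t¹ + ∑∑ t²)
      ≈⟨ +-congˡ (trans (∑∑-distrib-+ (λ i j → t⁰ i j + t¹ i j) t²)
                        (+-congʳ (∑∑-distrib-+ t⁰ t¹))) ⟨
    linear weight U + ∑∑ (λ i j → t⁰ i j + t¹ i j + t² i j)
      ≈⟨ +-congˡ (∑∑-cong (λ i j → pointwise (does (i <? j)) (adj i j) (lookup U i) (lookup U j))) ⟩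
    linear weight U + ∑<∑ (edgeCost I U)  ∎
    where
    open GVCInstance I

    t⁰ t¹ t² : Matrix n
    t⁰ i j = if does (i <? j) ∧ E₀ U i j then q⁰ i j else 0#
    t¹ i j = if does (i <? j) ∧ E₁ U i j then q¹ i j else 0#
    t² i j = if does (i <? j) ∧ E₂ U i j then q² i j else 0#

    0+0+x≈x : ∀ x → 0# + 0# + x ≈ x
    0+0+x≈x x = trans (+-congʳ (+-identityˡ 0#)) (+-identityˡ x)

    0+x+0≈x : ∀ x → 0# + x + 0# ≈ x
    0+x+0≈x x = trans (+-identityʳ _) (+-identityˡ x)

    x+0+0≈x : ∀ x → x + 0# + 0# ≈ x
    x+0+0≈x x = trans (+-identityʳ _) (+-identityʳ x)

    pointwise : ∀ d e b b′ {x y z} →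
      (if d ∧ (e ∧ (not b ∧ not b′)) then x else 0#)
        + (if d ∧ (e ∧ (b xor b′)) then y else 0#)
        + (if d ∧ (e ∧ (b ∧ b′)) then z else 0#)
        ≈ (if d then (if e then choose x y z b b′ else 0#) else 0#)
    pointwise false _     _     _     = 0+0+x≈x 0#
    pointwise true  false _     _     = 0+0+x≈x 0#
    pointwise true  true  false false = x+0+0≈x _
    pointwise true  true  false true  = 0+x+0≈x _
    pointwise true  true  true  false = 0+x+0≈x _
    pointwise true  true  true  true  = 0+0+x≈x _

  module _ (I : GVCInstance R n) where
    open GVCInstance I

    -- The weights of an instance are arbitrary off the edges, even on the diagonal. Masking them
    -- leaves the objective unchanged and makes the diagonal vanish, since the graph is loopless.
    onEdges : Matrix n → Matrix n
    onEdges q i j = if adj i j then q i j else 0#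

    onEdges-sym : {q : Matrix n} → Symmetric q → Symmetric (onEdges q)
    onEdges-sym q-sym i j rewrite adj-sym i j = if-cong (adj j i) (q-sym i j)

    onEdges-diag : (q : Matrix n) → ZeroDiagonal (onEdges q)
    onEdges-diag q i rewrite loopless i = refl

    edgeCosts : PairCosts n
    edgeCosts = record
      { q⁰      = onEdges q⁰
      ; q¹      = onEdges q¹
      ; q²      = onEdges q²
      ; q⁰-sym  = onEdges-sym q⁰-sym
      ; q¹-sym  = onEdges-sym q¹-sym
      ; q²-sym  = onEdges-sym q²-sym
      ; q⁰-diag = onEdges-diag q⁰
      ; q¹-diag = onEdges-diag q¹
      ; q²-diag = onEdges-diag q²
      }

    open PairCosts edgeCosts using
      (cost; cost-sym; cost-diag; slope; curvature; curvature-sym; curvature-diag)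

    edgeCost≈cost : ∀ U i j → edgeCost I U i j ≈ cost U i j
    edgeCost≈cost U i j with adj i j
    ... | true  = refl
    ... | false = sym (choose-zero refl refl refl (lookup U i) (lookup U j))

    -- Encodes twice the GVC objective up to a constant. The ordered double sum already meets each
    -- edge twice, so `curvature` enters unscaled, while the vertex weights have to be doubled
    -- explicitly.
    gvc⇒ubqp : UBQPInstance R n
    gvc⇒ubqp = record
      { a      = λ i → twice (weight i) + twice (rowSums slope i)
      ; Q      = curvature
      ; Q-sym  = curvature-sym
      ; Q-diag = curvature-diag
      }

    twice-gvcObjective : ∀ U →
      twice (gvcObjective R I U) ≈ ubqpObjective R gvc⇒ubqp U + ∑∑ (onEdges q⁰)
    twice-gvcObjective U = begin
      twice (gvcObjective R I U)
        ≈⟨ twice-cong (trans (gvcObjective≈ I U) (+-congˡ (∑<∑-cong (edgeCost≈cost U)))) ⟩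
      twice (linear weight U + ∑<∑ (cost U))
        ≈⟨ twice-+ (linear weight U) (∑<∑ (cost U)) ⟩
      twice (linear weight U) + twice (∑<∑ (cost U))
        ≈⟨ +-cong (sym (linear-+ weight weight U))
             (trans (twice-∑<∑ (cost U) (cost-sym U) (cost-diag U)) (∑∑-cost edgeCosts U)) ⟩
      v + ((k + l) + q)
        -- The part `k` that does not depend on `U` is moved to the end, to be cancelled when
        -- objectives are compared.
        ≈⟨ solve 4 (λ v k l q → v :+ ((k :+ l) :+ q) := ((v :+ l) :+ q) :+ k) refl v k l q ⟩
      ((v + l) + q) + k
        ≈⟨ +-congʳ (+-congʳ (linear-+ (λ i → twice (weight i)) (λ i → twice (rowSums slope i)) U)) ⟨
      ubqpObjective R gvc⇒ubqp U + k  ∎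
      where
      v = linear (λ i → twice (weight i)) U
      k = ∑∑ (onEdges q⁰)
      l = linear (λ i → twice (rowSums slope i)) U
      q = quadratic curvature U

  -- From UBQP to GVC.

  module _ (J : UBQPInstance R n) (P : PairCosts n) where
    open UBQPInstance J
    open PairCosts P

    -- An edge is counted once but an entry of `Q` twice, hence the doubled costs. The vertex
    -- weights subtract in advance the linear form that `slope` produces. On the complete graph
    -- every off-diagonal entry of `Q` has an edge to carry it.
    ubqp⇒gvc : GVCInstance R n
    ubqp⇒gvc = record
      { graph  = completeGraph n
      ; weight = λ i → a i - twice (rowSums slope i)
      ; q⁰     = λ i j → twice (q⁰ i j)
      ; q¹     = λ i j → twice (q¹ i j)
      ; q²     = λ i j → twice (q² i j)
      ; q⁰-sym = λ i j → twice-cong (q⁰-sym i j)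
      ; q¹-sym = λ i j → twice-cong (q¹-sym i j)
      ; q²-sym = λ i j → twice-cong (q²-sym i j)
      }

    edgeCost≈twice-cost : ∀ U i j → edgeCost ubqp⇒gvc U i j ≈ cost U i j + cost U i j
    edgeCost≈twice-cost U i j with i ≟ j
    -- There is no loop at `i`, so the left side is zero here and the zero diagonal of the pair
    -- costs must match it.
    ... | yes ≡.refl = sym (trans (twice-cong (cost-diag U i)) (+-identityˡ 0#))
    ... | no  _      = choose-twice (q⁰ i j) (q¹ i j) (q² i j) (lookup U i) (lookup U j)

    -- Only `curvature` has to agree with `Q`: the slope terms cancel against the vertex weights and
    -- the `q⁰` terms add up to a constant. So one computation covers both choices of costs below.
    gvcObjective-ubqp⇒gvc : (∀ i j → curvature i j ≈ Q i j) → ∀ U →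
      gvcObjective R ubqp⇒gvc U ≈ ubqpObjective R J U + ∑∑ q⁰
    gvcObjective-ubqp⇒gvc curvature≈Q U = begin
      gvcObjective R ubqp⇒gvc U
        ≈⟨ gvcObjective≈ ubqp⇒gvc U ⟩
      linear w U + ∑<∑ (edgeCost ubqp⇒gvc U)
        ≈⟨ +-congˡ (trans (∑<∑-cong (edgeCost≈twice-cost U)) (∑<∑-distrib-+ (cost U) (cost U))) ⟩
      linear w U + twice (∑<∑ (cost U))
        ≈⟨ +-congˡ (trans (twice-∑<∑ (cost U) (cost-sym U) (cost-diag U)) (∑∑-cost P U)) ⟩
      linear w U + ((k + l) + quadratic curvature U)
        ≈⟨ solve 4 (λ v k l q → v :+ ((k :+ l) :+ q) := ((v :+ l) :+ q) :+ k) refl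
             (linear w U) k l (quadratic curvature U) ⟩
      ((linear w U + l) + quadratic curvature U) + k
        ≈⟨ +-congʳ (+-cong (sym (linear-+ w s U))
             (∑∑-cong (λ i j → *-congʳ (*-congʳ (curvature≈Q i j))))) ⟩
      (linear (λ i → w i + s i) U + quadratic Q U) + k
        ≈⟨ +-congʳ (+-congʳ (sum-cong-≋ (λ i → *-congʳ (//-rightDividesˡ (s i) (a i))))) ⟩
      ubqpObjective R J U + k  ∎
      where
      s w : Vector Carrier n
      s i = twice (rowSums slope i)
      w i = a i - s i
      k = ∑∑ q⁰
      l = linear s U

  module _ (J : UBQPInstance R n) where
    open UBQPInstance J

    outsideCosts insideCosts : PairCosts n
    outsideCosts = record
      { q⁰ = Q ; q¹ = λ _ _ → 0# ; q² = λ _ _ → 0#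
      ; q⁰-sym  = Q-sym  ; q¹-sym  = λ _ _ → refl ; q²-sym  = λ _ _ → refl
      ; q⁰-diag = Q-diag ; q¹-diag = λ _ → refl   ; q²-diag = λ _ → refl
      }
    insideCosts = record
      { q⁰ = λ _ _ → 0# ; q¹ = λ _ _ → 0# ; q² = Q
      ; q⁰-sym  = λ _ _ → refl ; q¹-sym  = λ _ _ → refl ; q²-sym  = Q-sym
      ; q⁰-diag = λ _ → refl   ; q¹-diag = λ _ → refl   ; q²-diag = Q-diag
      }

    curvature-outsideCosts : ∀ i j → PairCosts.curvature outsideCosts i j ≈ Q i j
    curvature-outsideCosts i j = begin
      0# - (q + twice (0# - q))  ≈⟨ +-congˡ (-‿cong (+-assoc q _ _)) ⟨
      0# - ((q + (0# - q)) + (0# - q))  ≈⟨ +-congˡ (-‿cong (+-congʳ (x+[y-x]≈y q 0#))) ⟩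
      0# - (0# + (0# - q))  ≈⟨ +-congˡ (-‿cong (+-identityˡ _)) ⟩
      -- The leading zero is expanded to `q + (0# - q)`, so that subtracting `0# - q` leaves `q`.
      0# - (0# - q)  ≈⟨ +-congʳ (x+[y-x]≈y q 0#) ⟨
      (q + (0# - q)) - (0# - q)  ≈⟨ //-rightDividesʳ (0# - q) q ⟩
      q  ∎
      where q = Q i j

    curvature-insideCosts : ∀ i j → PairCosts.curvature insideCosts i j ≈ Q i j
    curvature-insideCosts i j = begin
      Q i j - (0# + twice (0# - 0#))  ≈⟨ +-congˡ (-‿cong 0+twice[0-0]≈0) ⟩
      Q i j - 0#  ≈⟨ +-congˡ ε⁻¹≈ε ⟩
      Q i j + 0#  ≈⟨ +-identityʳ (Q i j) ⟩
      Q i j  ∎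

  -- Order and transfer of optimal solutions.

  +-cancelʳ-< : ∀ z {x y} → x + z < y + z → x < y
  +-cancelʳ-< z {x} {y} x+z<y+z =
    <-respˡ-≈ (//-rightDividesʳ z x)
      (<-respʳ-≈ (//-rightDividesʳ z y) (+-monoˡ-< (x + z) (y + z) (- z) x+z<y+z))

  twice-mono-< : ∀ {x y} → x < y → twice x < twice y
  twice-mono-< {x} {y} x<y =
    <-trans (+-monoˡ-< x y x x<y) (<-respˡ-≈ (+-comm x y) (+-monoˡ-< x y y x<y))

  -- As `≤` is a negated `<`, optimality is proved by refutation: a `W` strictly better for GVC
  -- stays strictly better after doubling and after cancelling the constant, against the optimality
  -- of `U` for UBQP.
  GVC⇒UBQP : FormulatedAs R (GVC R) (UBQP R)
  GVC⇒UBQP I = gvc⇒ubqp I , λ U U-optimal W W<U → U-optimal W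
    (+-cancelʳ-< (∑∑ (onEdges I (GVCInstance.q⁰ I)))
      (<-respˡ-≈ (twice-gvcObjective I W)
        (<-respʳ-≈ (twice-gvcObjective I U) (twice-mono-< W<U))))

  ubqp⇒gvc-optimal : (J : UBQPInstance R n) (P : PairCosts n) →
    (∀ i j → PairCosts.curvature P i j ≈ UBQPInstance.Q J i j) → ∀ U →
    MinimizationProblem.Optimal (GVC R) (ubqp⇒gvc J P) U →
    MinimizationProblem.Optimal (UBQP R) J U
  ubqp⇒gvc-optimal J P curvature≈Q U U-optimal W W<U = U-optimal W
    (<-respˡ-≈ (sym (gvcObjective-ubqp⇒gvc J P curvature≈Q W))
      (<-respʳ-≈ (sym (gvcObjective-ubqp⇒gvc J P curvature≈Q U))
        (+-monoˡ-< _ _ (∑∑ (PairCosts.q⁰ P)) W<U)))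

  UBQP⇒GVC1 : FormulatedAs R (UBQP R) (GVC1 R)
  UBQP⇒GVC1 J =
    (ubqp⇒gvc J (outsideCosts J)
      -- The costs required to vanish are doubled zeros, `0# + 0#`.
      , (λ _ _ _ → +-identityˡ 0#) , (λ _ _ _ → +-identityˡ 0#))
    , ubqp⇒gvc-optimal J (outsideCosts J) (curvature-outsideCosts J)

  UBQP⇒GVC2 : FormulatedAs R (UBQP R) (GVC2 R)
  UBQP⇒GVC2 J =
    (ubqp⇒gvc J (insideCosts J)
      , (λ _ _ _ → +-identityˡ 0#) , (λ _ _ _ → +-identityˡ 0#))
    , ubqp⇒gvc-optimal J (insideCosts J) (curvature-insideCosts J)

theorem2 : ∀ {c ℓ₁ ℓ₂} (R : RealNumbers c ℓ₁ ℓ₂) →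
    Equivalent R (GVC R) (UBQP R) ×
    Equivalent R (GVC1 R) (UBQP R) ×
    Equivalent R (GVC2 R) (UBQP R)
theorem2 R =
  (GVC⇒UBQP R ,
    -- Either choice of costs yields a GVC instance; the inside costs are taken.
    λ J → ubqp⇒gvc R J (insideCosts R J)
        , ubqp⇒gvc-optimal R J (insideCosts R J) (curvature-insideCosts R J)) ,
  -- GVC1 and GVC2 inherit the objective of GVC, so the reduction of the underlying instance applies
  -- as it is.
  ((λ I → GVC⇒UBQP R (proj₁ I)) , UBQP⇒GVC1 R) ,
  ((λ I → GVC⇒UBQP R (proj₁ I)) , UBQP⇒GVC2 R)
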